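{- Let $n\geq 3$ be an integer and let $m$ be an integer with $m\geq 2n$. Then the b-chromatic number of the Kneser graph $KG(m,n)$ satisfies $$\chi_b(KG(m,n))\;\geq\; 2\binom{\lfloor m/2\rfloor}{n}.$$
   Context: For a positive integer $m$, $[m]$ denotes the set $\{0,1,\ldots,m-1\}$, and for a set $X$, $\binom{X}{n}$ denotes the collection of all $n$-element subsets of $X$. For $m\geq 2n$, the Kneser graph $KG(m,n)$ is the graph with vertex set $\binom{[m]}{n}$ in which two vertices $A$ and $B$ are adjacent if and only if $A\cap B=\emptyset$. The b-chromatic number $\chi_b(G)$ of a graph $G$ is the largest positive integer $t$ such that there exists a proper vertex coloring of $G$ with $t$ colors (all $t$ color classes nonempty) in which every color class contains at least one vertex that has a neighbor in each of the other color classes. In the displayed inequality $\binom{\lfloor m/2\rfloor}{n}$ is the usual binomial coefficient. -}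

module Defs where

open import Data.Empty using (⊥-elim)
open import Data.Fin using (Fin)
import Data.Fin.Properties as Fin
open import Data.Fin.Subset using (Subset; inside; outside; _∩_; ∣_∣; Empty)
open import Data.Fin.Subset.Properties using (nonempty?; ∩-comm; ∩-idem)
open import Data.List using (List; []; _∷_; map; _++_; length; lookup)
open import Data.List.Membership.Propositional using (_∈_; find; lose)
open import Data.List.Membership.Propositional.Properties
  using (∈-map⁺; ∈-++⁺ˡ; ∈-++⁺ʳ)
import Data.List.Relation.Unary.All as All
open import Data.List.Relation.Unary.Any using (here; index)
import Data.List.Relation.Unary.Any as Any
open import Data.List.Relation.Unary.Any.Properties using (lookup-index)
open import Data.Nat using (ℕ; zero; suc; _≤_; z≤n; NonZero)
open import Data.Nat.Properties using (m≤n⇒m<n∨m≡n; ≤-pred)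
open import Data.Product using (Σ; ∃; _×_; _,_; proj₁)
open import Data.Sum using (inj₁; inj₂)
open import Data.Vec using (Vec; []; _∷_; tabulate)
import Data.Vec as Vec
open import Data.Vec.Properties using (lookup∘tabulate)
open import Function using (_∘_)
open import Relation.Binary.Definitions using (Symmetric; Irreflexive)
import Relation.Binary.Definitions as B
open import Relation.Binary.PropositionalEquality
  using (_≡_; _≢_; _≗_; refl; sym; trans; cong; subst)
open import Relation.Nullary using (¬_; Dec; yes; no; ¬?)
open import Relation.Nullary.Decidable using (map′; _×-dec_; _→-dec_)
open import Relation.Unary using (Decidable)

record FiniteSimpleGraph : Set₁ where
  infix 4 _~_ _~?_
  field
    V        : Set
    _~_      : V → V → Set
    ~-sym    : Symmetric _~_
    ~-irrefl : Irreflexive _≡_ _~_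
    _~?_     : B.Decidable _~_
    vertices : List V
    complete : ∀ v → v ∈ vertices

module _ (G : FiniteSimpleGraph) where
  open FiniteSimpleGraph G

  Coloring : ℕ → Set
  Coloring t = V → Fin t

  Proper : ∀ {t} → Coloring t → Set
  Proper c = ∀ u v → u ~ v → c u ≢ c v

  SeesAllOtherColors : ∀ {t} → Coloring t → V → Set
  SeesAllOtherColors c v = ∀ j → j ≢ c v → ∃ λ u → v ~ u × c u ≡ j

  -- The second component makes every color class nonempty.
  IsBColoring : ∀ {t} → Coloring t → Set
  IsBColoring c =
    Proper c × (∀ i → ∃ λ v → c v ≡ i × SeesAllOtherColors c v)

  HasBColoring : ℕ → Set
  HasBColoring t = Σ (Coloring t) IsBColoring

  private
    ∃? : ∀ {P : V → Set} → Decidable P → Dec (∃ P)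
    ∃? P? = map′ (λ p → let v , _ , Pv = find p in v , Pv)
                 (λ (v , Pv) → lose (complete v) Pv)
                 (Any.any? P? vertices)

    ∀? : ∀ {P : V → Set} → Decidable P → Dec (∀ v → P v)
    ∀? P? = map′ (λ ps v → All.lookup ps (complete v))
                 (λ f → All.tabulate (λ {v} _ → f v))
                 (All.all? P? vertices)

    ∃Vec? : ∀ {t} k {P : Vec (Fin t) k → Set} →
            Decidable P → Dec (∃ P)
    ∃Vec? zero    P? = map′ ([] ,_) (λ { ([] , p) → p }) (P? [])
    ∃Vec? (suc k) P? =
      map′ (λ (x , xs , p) → x ∷ xs , p)
           (λ { (x ∷ xs , p) → x , xs , p })
           (Fin.any? λ x → ∃Vec? k λ xs → P? (x ∷ xs))

    position : V → Fin (length vertices)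
    position v = index (complete v)

    lookup-position : ∀ v → lookup vertices (position v) ≡ v
    lookup-position v = sym (lookup-index (complete v))

    fromVec : ∀ {t} → Vec (Fin t) (length vertices) → Coloring t
    fromVec xs = Vec.lookup xs ∘ position

    toVec : ∀ {t} → Coloring t → Vec (Fin t) (length vertices)
    toVec c = tabulate (c ∘ lookup vertices)

    fromVec∘toVec : ∀ {t} (c : Coloring t) → fromVec (toVec c) ≗ c
    fromVec∘toVec c v =
      trans (lookup∘tabulate (c ∘ lookup vertices) (position v))
            (cong c (lookup-position v))

  isBColoring? : ∀ {t} → Decidable (IsBColoring {t})
  isBColoring? c =
    ∀? (λ u → ∀? λ v → (u ~? v) →-dec ¬? (c u Fin.≟ c v))
    ×-dec
    Fin.all? λ i → ∃? λ v → (c v Fin.≟ i) ×-dec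
      Fin.all? λ j → ¬? (j Fin.≟ c v) →-dec
        ∃? λ u → (v ~? u) ×-dec (c u Fin.≟ j)

  isBColoring-resp-≗ : ∀ {t} {c d : Coloring t} →
                       c ≗ d → IsBColoring c → IsBColoring d
  isBColoring-resp-≗ c≗d (proper , dominating) =
    (λ u v u~v du≡dv →
       proper u v u~v (trans (c≗d u) (trans du≡dv (sym (c≗d v))))) ,
    λ i → let v , cv≡i , sees = dominating i in
      v , trans (sym (c≗d v)) cv≡i ,
      λ j j≢dv →
        let u , v~u , cu≡j = sees j (λ j≡cv → j≢dv (trans j≡cv (c≗d v))) in
        u , v~u , trans (sym (c≗d u)) cu≡j

  hasBColoring? : Decidable HasBColoring
  hasBColoring? t =
    map′ (λ (xs , b) → fromVec xs , b)
         (λ (c , b) →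
            toVec c , isBColoring-resp-≗ (sym ∘ fromVec∘toVec c) b)
         (∃Vec? (length vertices) (isBColoring? ∘ fromVec))

  hasBColoring⇒≤ : ∀ {t} → HasBColoring t → t ≤ length vertices
  hasBColoring⇒≤ (c , _ , dominating) =
    Fin.injective⇒≤ {f = λ i → position (proj₁ (dominating i))}
      λ {i} {j} eq →
        let v , cv≡i , _ = dominating i
            w , cw≡j , _ = dominating j
            v≡w = trans (sym (lookup-position v))
                        (trans (cong (lookup vertices) eq)
                               (lookup-position w))
        in trans (sym cv≡i) (trans (cong c v≡w) cw≡j)

-- The largest t ≤ b satisfying P, or 0 if there is none.
largest≤ : ∀ {P : ℕ → Set} → Decidable P → ℕ → ℕ
largest≤ P? zero    = zero
largest≤ P? (suc b) with P? (suc b)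
... | yes _ = suc b
... | no  _ = largest≤ P? b

largest≤-upper : ∀ {P : ℕ → Set} (P? : Decidable P) b {t} →
                 t ≤ b → P t → t ≤ largest≤ P? b
largest≤-upper P? zero    t≤b Pt = t≤b
largest≤-upper P? (suc b) t≤b Pt with P? (suc b)
... | yes _ = t≤b
... | no ¬P with m≤n⇒m<n∨m≡n t≤b
...   | inj₁ t<1+b = largest≤-upper P? b (≤-pred t<1+b) Pt
...   | inj₂ refl  = ⊥-elim (¬P Pt)

largest≤-attained : ∀ {P : ℕ → Set} (P? : Decidable P) b {t} →
                    t ≤ b → P t → P (largest≤ P? b)
largest≤-attained P? zero    z≤n Pt = Pt
largest≤-attained P? (suc b) t≤b Pt with P? (suc b)
... | yes P1+b = P1+b
... | no ¬P with m≤n⇒m<n∨m≡n t≤b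
...   | inj₁ t<1+b = largest≤-attained P? b (≤-pred t<1+b) Pt
...   | inj₂ refl  = ⊥-elim (¬P Pt)

-- By hasBColoring⇒≤ no t beyond the number of listed vertices can occur, so
-- the bounded search finds the maximum over all t; see the two lemmas below.
χ_b : FiniteSimpleGraph → ℕ
χ_b G =
  largest≤ (hasBColoring? G) (length (FiniteSimpleGraph.vertices G))

χ_b-upper : ∀ G {t} → HasBColoring G t → t ≤ χ_b G
χ_b-upper G h = largest≤-upper (hasBColoring? G) _ (hasBColoring⇒≤ G h) h

χ_b-attained : ∀ G {t} → HasBColoring G t → HasBColoring G (χ_b G)
χ_b-attained G h =
  largest≤-attained (hasBColoring? G) _ (hasBColoring⇒≤ G h) h

_-subsetsOf_ : ℕ → ℕ → Set
n -subsetsOf m = Σ (Subset m) λ A → ∣ A ∣ ≡ n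

Disjoint : ∀ {m n} → n -subsetsOf m → n -subsetsOf m → Set
Disjoint (A , _) (B , _) = Empty (A ∩ B)

private
  cons-in : ∀ {m n} → n -subsetsOf m → suc n -subsetsOf suc m
  cons-in (A , eq) = inside ∷ A , cong suc eq

  cons-out : ∀ {m n} → n -subsetsOf m → n -subsetsOf suc m
  cons-out (A , eq) = outside ∷ A , eq

allSubsets : ∀ m n → List (n -subsetsOf m)
allSubsets zero    zero    = ([] , refl) ∷ []
allSubsets zero    (suc n) = []
allSubsets (suc m) zero    = map cons-out (allSubsets m zero)
allSubsets (suc m) (suc n) =
  map cons-in (allSubsets m n) ++ map cons-out (allSubsets m (suc n))

allSubsets-complete : ∀ m n (A : n -subsetsOf m) → A ∈ allSubsets m n
allSubsets-complete zero zero ([] , refl) = here refl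
allSubsets-complete (suc m) zero (outside ∷ A , eq) =
  ∈-map⁺ cons-out (allSubsets-complete m zero (A , eq))
allSubsets-complete (suc m) (suc n) (inside ∷ A , refl) =
  ∈-++⁺ˡ (∈-map⁺ cons-in (allSubsets-complete m n (A , refl)))
allSubsets-complete (suc m) (suc n) (outside ∷ A , eq) =
  ∈-++⁺ʳ (map cons-in (allSubsets m n))
    (∈-map⁺ cons-out (allSubsets-complete m (suc n) (A , eq)))

private
  nonempty : ∀ {m} n .{{_ : NonZero n}} (A : Subset m) →
             ∣ A ∣ ≡ n → ¬ Empty A
  nonempty (suc n) (inside  ∷ A) eq e = e (Fin.zero , Vec.here)
  nonempty (suc n) (outside ∷ A) eq e =
    nonempty (suc n) A eq λ (x , x∈A) → e (Fin.suc x , Vec.there x∈A)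

-- For n = 0 the only vertex would be disjoint from itself, a loop; hence
-- the NonZero argument.
KG : (m n : ℕ) .{{_ : NonZero n}} → FiniteSimpleGraph
KG m n = record
  { V        = n -subsetsOf m
  ; _~_      = Disjoint
  ; ~-sym    = λ {(A , _)} {(B , _)} → subst Empty (∩-comm A B)
  ; ~-irrefl = λ { {A , eq} refl d →
                   nonempty n A eq (subst Empty (∩-idem A) d) }
  ; _~?_     = λ (A , _) (B , _) → ¬? (nonempty? (A ∩ B))
  ; vertices = allSubsets m n
  ; complete = allSubsets-complete m n
  }

module Submission where

-- For m = 2k split [m] into two copies X, Y of [k], so that a vertex is a
-- pair (U , W) of subsets of [k] with ∣U∣ + ∣W∣ = n, and use the colours
-- (A , b) with A an n-subset of [k] and b a side. A vertex gets a colour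
-- (A , b) with U ∪ W ⊆ A. Two disjoint vertices with the same A are
-- complementary in A ⊔ A, so the colouring is proper as soon as b differs on
-- complements. For ∣U∣ = 0, 1, n − 1, n the side is Y, X, Y, X, which is
-- consistent because n ≥ 3. The dominating vertex of (A , X) is (A , ∅): it is
-- disjoint from every (∅ , B), and for B ≠ A from ({x} , B − x) with x ∈ B ∖ A.
-- For m = 2k + 1 one further colour takes all vertices containing the
-- additional point.

open import Defs
open import Data.Bool using (Bool; true; false; not)
open import Data.Bool.Properties using (¬-not; not-¬)
open import Data.Empty using (⊥-elim)
open import Data.Fin using (Fin; zero; suc)
import Data.Fin.Properties as Fin
open import Data.Fin.Subset using (Subset; inside; outside; _∈_; _∉_; _⊆_; _⊈_; _∩_; _∪_; _─_; _-_; ∁; ⊤; ⊥; ⁅_⁆; ∣_∣; Empty)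
open import Data.Fin.Subset.Properties
open import Data.Nat using (ℕ; zero; suc; _+_; _∸_; _≤_; _<_; _≥_; _*_; ⌊_/2⌋; NonZero; z≤n; s≤s)
open import Data.Nat.Combinatorics using (_C_; nCk+nC[k+1]≡[n+1]C[k+1])
open import Data.Nat.Properties
open import Algebra.Properties.CommutativeSemigroup +-commutativeSemigroup using (interchange)
open import Data.Product using (Σ; ∃; _×_; _,_; proj₁; proj₂)
open import Data.Product.Function.NonDependent.Propositional using (_×-↔_)
open import Data.Sum using (_⊎_; inj₁; inj₂; [_,_]′)
open import Data.Sum.Function.Propositional using (_⊎-↔_)
open import Data.Sum.Properties using (inj₂-injective)
import Data.Unit as Unit
open import Data.Vec using ([]; _∷_; _++_; take; drop; here; there)
open import Data.Vec.Properties using (take++drop≡id; zipWith-++; ++-injectiveˡ; ++-injectiveʳ)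
open import Function using (_∘_; id; _↔_; mk↔ₛ′; Inverse)
open import Function.Properties.Inverse using (↔-sym; ↔-trans)
open import Relation.Binary.PropositionalEquality
open import Relation.Nullary using (yes; no; ¬?; contradiction)
open import Relation.Nullary.Decidable using (_×-dec_; decidable-stable)

private variable
  k m n : ℕ

-- Sizes, disjointness and concatenation of subsets.

∣p++q∣≡∣p∣+∣q∣ : (p : Subset k) (q : Subset m) → ∣ p ++ q ∣ ≡ ∣ p ∣ + ∣ q ∣
∣p++q∣≡∣p∣+∣q∣ []            q = refl
∣p++q∣≡∣p∣+∣q∣ (inside  ∷ p) q = cong suc (∣p++q∣≡∣p∣+∣q∣ p q)
∣p++q∣≡∣p∣+∣q∣ (outside ∷ p) q = ∣p++q∣≡∣p∣+∣q∣ p q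

∣p∪q∣≤∣p∣+∣q∣ : (p q : Subset k) → ∣ p ∪ q ∣ ≤ ∣ p ∣ + ∣ q ∣
∣p∪q∣≤∣p∣+∣q∣ []            []            = z≤n
∣p∪q∣≤∣p∣+∣q∣ (inside  ∷ p) (inside  ∷ q) =
  s≤s (≤-trans (∣p∪q∣≤∣p∣+∣q∣ p q) (+-monoʳ-≤ ∣ p ∣ (n≤1+n ∣ q ∣)))
∣p∪q∣≤∣p∣+∣q∣ (inside  ∷ p) (outside ∷ q) = s≤s (∣p∪q∣≤∣p∣+∣q∣ p q)
∣p∪q∣≤∣p∣+∣q∣ (outside ∷ p) (inside  ∷ q) =
  ≤-trans (s≤s (∣p∪q∣≤∣p∣+∣q∣ p q)) (≤-reflexive (sym (+-suc ∣ p ∣ ∣ q ∣)))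
∣p∪q∣≤∣p∣+∣q∣ (outside ∷ p) (outside ∷ q) = ∣p∪q∣≤∣p∣+∣q∣ p q

∣p∪q∣≡∣p∣+∣q∣ : (p q : Subset k) → Empty (p ∩ q) → ∣ p ∪ q ∣ ≡ ∣ p ∣ + ∣ q ∣
∣p∪q∣≡∣p∣+∣q∣ []            []            e = refl
∣p∪q∣≡∣p∣+∣q∣ (inside  ∷ p) (inside  ∷ q) e = ⊥-elim (e (zero , here))
∣p∪q∣≡∣p∣+∣q∣ (inside  ∷ p) (outside ∷ q) e =
  cong suc (∣p∪q∣≡∣p∣+∣q∣ p q (drop-∷-Empty e))
∣p∪q∣≡∣p∣+∣q∣ (outside ∷ p) (inside  ∷ q) e =
  trans (cong suc (∣p∪q∣≡∣p∣+∣q∣ p q (drop-∷-Empty e))) (sym (+-suc ∣ p ∣ ∣ q ∣))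
∣p∪q∣≡∣p∣+∣q∣ (outside ∷ p) (outside ∷ q) e = ∣p∪q∣≡∣p∣+∣q∣ p q (drop-∷-Empty e)

∪-lub : {p q r : Subset k} → p ⊆ r → q ⊆ r → p ∪ q ⊆ r
∪-lub {p = p} {q} p⊆r q⊆r x∈p∪q = [ (λ i → p⊆r i) , (λ i → q⊆r i) ]′ (x∈p∪q⁻ p q x∈p∪q)

p⊈q⇒∃∈∉ : {p q : Subset k} → p ⊈ q → ∃ λ x → x ∈ p × x ∉ q
p⊈q⇒∃∈∉ {p = p} {q} p⊈q with Fin.any? (λ x → (x ∈? p) ×-dec ¬? (x ∈? q))
... | yes found = found
... | no  none  = ⊥-elim (p⊈q λ {x} x∈p →
        decidable-stable (x ∈? q) λ x∉q → none (x , x∈p , x∉q))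

p⊆q∧∣q∣≤∣p∣⇒p≡q : {p q : Subset k} → p ⊆ q → ∣ q ∣ ≤ ∣ p ∣ → p ≡ q
p⊆q∧∣q∣≤∣p∣⇒p≡q {p = p} {q} p⊆q ∣q∣≤∣p∣ with q ⊆? p
... | yes q⊆p = ⊆-antisym p⊆q q⊆p
... | no  q⊈p =
  contradiction ∣q∣≤∣p∣ (<⇒≱ (p⊂q⇒∣p∣<∣q∣ ((λ i → p⊆q i) , p⊈q⇒∃∈∉ q⊈p)))

Empty-comm : (p q : Subset k) → Empty (p ∩ q) → Empty (q ∩ p)
Empty-comm p q = subst Empty (∩-comm p q)

Empty-p∩⊥ : (p : Subset k) → Empty (p ∩ ⊥)
Empty-p∩⊥ p (x , x∈) = ∉⊥ (p∩q⊆q p ⊥ x∈)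

Empty-⊥∩p : (p : Subset k) → Empty (⊥ ∩ p)
Empty-⊥∩p p (x , x∈) = ∉⊥ (p∩q⊆p ⊥ p x∈)

Empty-p∩[q─p] : (p q : Subset k) → Empty (p ∩ (q ─ p))
Empty-p∩[q─p] (inside  ∷ p) (_ ∷ q) (suc x , there x∈) = Empty-p∩[q─p] p q (x , x∈)
Empty-p∩[q─p] (outside ∷ p) (_ ∷ q) (suc x , there x∈) = Empty-p∩[q─p] p q (x , x∈)

Empty-⁅x⁆∩p : {x : Fin k} {p : Subset k} → x ∉ p → Empty (⁅ x ⁆ ∩ p)
Empty-⁅x⁆∩p {x = x} {p} x∉p (y , y∈) =
  x∉p (subst (_∈ p) (x∈⁅y⁆⇒x≡y x (p∩q⊆p ⁅ x ⁆ p y∈)) (p∩q⊆q ⁅ x ⁆ p y∈))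

⁅x⁆∪[p-x]≡p : {x : Fin k} {p : Subset k} → x ∈ p → ⁅ x ⁆ ∪ (p - x) ≡ p
⁅x⁆∪[p-x]≡p {p = _ ∷ p} here       =
  cong (inside ∷_) (trans (∪-identityˡ (p ─ ⊥)) (p─⊥≡p p))
⁅x⁆∪[p-x]≡p {p = s ∷ p} (there x∈p) = cong (s ∷_) (⁅x⁆∪[p-x]≡p x∈p)

Empty-++⁺ : (p : Subset k) {q : Subset m} → Empty p → Empty q → Empty (p ++ q)
Empty-++⁺ []      ep eq                 = eq
Empty-++⁺ (s ∷ p) ep eq (zero  , here)    = ep (zero , here)
Empty-++⁺ (s ∷ p) ep eq (suc x , there i) = Empty-++⁺ p (drop-∷-Empty ep) eq (x , i)

Empty-++⁻ : (p : Subset k) {q : Subset m} → Empty (p ++ q) → Empty p × Empty q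
Empty-++⁻ []      e = (λ ()) , e
Empty-++⁻ (s ∷ p) e with Empty-++⁻ p (drop-∷-Empty e)
... | ep , eq = (λ { (zero , here) → e (zero , here) ; (suc x , there i) → ep (x , i) }) , eq

++-disjoint⁺ : (p p′ : Subset k) (q q′ : Subset m) → Empty (p ∩ p′) → Empty (q ∩ q′) →
               Empty ((p ++ q) ∩ (p′ ++ q′))
++-disjoint⁺ p p′ q q′ ep eq =
  subst Empty (sym (zipWith-++ _ p q p′ q′)) (Empty-++⁺ (p ∩ p′) ep eq)

++-disjoint⁻ : (p p′ : Subset k) (q q′ : Subset m) → Empty ((p ++ q) ∩ (p′ ++ q′)) →
               Empty (p ∩ p′) × Empty (q ∩ q′)
++-disjoint⁻ p p′ q q′ e = Empty-++⁻ (p ∩ p′) (subst Empty (zipWith-++ _ p q p′ q′) e)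

-- Subsets of fixed size: equality, extension, counting.

-subsetsOf-≡ : {A B : n -subsetsOf k} → proj₁ A ≡ proj₁ B → A ≡ B
-subsetsOf-≡ {A = A , a} {.A , b} refl = cong (A ,_) (≡-irrelevant a b)

⊆⇒-subsetsOf-≡ : (A B : n -subsetsOf k) → proj₁ A ⊆ proj₁ B → A ≡ B
⊆⇒-subsetsOf-≡ (A , a) (B , b) A⊆B =
  -subsetsOf-≡ (p⊆q∧∣q∣≤∣p∣⇒p≡q A⊆B (≤-reflexive (trans b (sym a))))

superset : (p : Subset k) → ∣ p ∣ ≤ n → n ≤ k → Σ (n -subsetsOf k) λ A → p ⊆ proj₁ A
superset []            _   z≤n = ([] , refl) , id
superset (inside  ∷ p) (s≤s ∣p∣≤n) (s≤s n≤k) with superset p ∣p∣≤n n≤k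
... | (A , a) , p⊆A = (inside ∷ A , cong suc a) , in⊆in p⊆A
superset {suc k} (outside ∷ p) ∣p∣≤n n≤1+k with m≤n⇒m<n∨m≡n n≤1+k
-- As many points are still wanted as are left, so all of them are taken; otherwise the current
-- point can be skipped.
... | inj₂ refl = (⊤ , ∣⊤∣≡n (suc k)) , ⊆⊤
... | inj₁ (s≤s n≤k) with superset p ∣p∣≤n n≤k
...   | (A , a) , p⊆A = (outside ∷ A , a) , out⊆ p⊆A

subset : ∀ n (p : Subset k) → n ≤ ∣ p ∣ → Σ (n -subsetsOf k) λ A → proj₁ A ⊆ p
subset {k} zero    p             _           = (⊥ , ∣⊥∣≡0 k) , ⊥⊆
subset     (suc n) (inside  ∷ p) (s≤s n≤∣p∣) with subset n p n≤∣p∣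
... | (A , a) , A⊆p = (inside ∷ A , cong suc a) , in⊆in A⊆p
subset     (suc n) (outside ∷ p) n<∣p∣       with subset (suc n) p n<∣p∣
... | (A , a) , A⊆p = (outside ∷ A , a) , out⊆ A⊆p

-- Induction along Pascal's rule, splitting on whether the first point belongs to the subset.
-subsetsOf↔Fin : ∀ k n → (n -subsetsOf k) ↔ Fin (k C n)
-subsetsOf↔Fin zero    zero    =
  mk↔ₛ′ (λ _ → zero) (λ _ → [] , refl) (λ { zero → refl }) λ { ([] , refl) → refl }
-subsetsOf↔Fin zero    (suc n) = mk↔ₛ′ (λ { ([] , ()) }) (λ ()) (λ ()) λ { ([] , ()) }
-subsetsOf↔Fin (suc k) zero    = mk↔ₛ′ (λ _ → zero) (λ _ → ⊥ , ∣⊥∣≡0 (suc k))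
  (λ { zero → refl }) λ A → ⊆⇒-subsetsOf-≡ (⊥ , ∣⊥∣≡0 (suc k)) A ⊥⊆
-subsetsOf↔Fin (suc k) (suc n) =
  subst (λ t → (suc n -subsetsOf suc k) ↔ Fin t) (nCk+nC[k+1]≡[n+1]C[k+1] k n)
    (↔-trans byHead (↔-trans (-subsetsOf↔Fin k n ⊎-↔ -subsetsOf↔Fin k (suc n))
                             (↔-sym Fin.+↔⊎)))
  where
  byHead : (suc n -subsetsOf suc k) ↔ (n -subsetsOf k ⊎ suc n -subsetsOf k)
  byHead = mk↔ₛ′
    (λ { (inside ∷ A , a) → inj₁ (A , suc-injective a) ; (outside ∷ A , a) → inj₂ (A , a) })
    [ (λ (A , a) → inside ∷ A , cong suc a) , (λ (A , a) → outside ∷ A , a) ]′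
    (λ { (inj₁ _) → cong inj₁ (-subsetsOf-≡ refl) ; (inj₂ _) → refl })
    λ { (inside ∷ A , a) → -subsetsOf-≡ refl ; (outside ∷ A , a) → refl }

-- b-colourings with an arbitrary set of colours.

module _ (G : FiniteSimpleGraph) where
  open FiniteSimpleGraph G

  -- The palette `K` is any type, so that colours can be pairs (A , b), possibly with one extra
  -- colour; they are numbered only at the end.
  IsBColoringBy : {K : Set} → (V → K) → Set
  IsBColoringBy c =
    (∀ u v → u ~ v → c u ≢ c v) ×
    (∀ i → ∃ λ v → c v ≡ i × (∀ j → j ≢ c v → ∃ λ u → v ~ u × c u ≡ j))

  hasBColoring : ∀ {t} {K : Set} → K ↔ Fin t → (c : V → K) → IsBColoringBy c → HasBColoring G t
  hasBColoring K↔t c (proper , dominating) =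
    to ∘ c , (λ u v u~v → proper u v u~v ∘ to-injective) , λ i →
      let v , cv≡ , sees = dominating (from i) in
      v , trans (cong to cv≡) (inverseˡ refl) , λ j j≢ →
        let u , v~u , cu≡ = sees (from j) (λ eq → j≢ (trans (sym (inverseˡ refl)) (cong to eq)))
        in u , v~u , trans (cong to cu≡) (inverseˡ refl)
    where
    open Inverse K↔t
    to-injective : ∀ {x y} → to x ≡ to y → x ≡ y
    to-injective eq = trans (sym (inverseʳ refl)) (trans (cong from eq) (inverseʳ refl))

-- The side of a subset U of A, opposite on complements.

-- The value at an empty A is junk.
leading : Subset k → Subset k → Bool
leading []            []      = false
leading (inside  ∷ A) (u ∷ U) = u
leading (outside ∷ A) (_ ∷ U) = leading A U

-- `leading A U` tells whether U contains the least element of A. That of `p ∪ q` lies in exactly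
-- one of two disjoint sets, and it exists because the union is nonempty.
leading-complement : (p q : Subset k) → Empty (p ∩ q) → 0 < ∣ p ∪ q ∣ →
                     leading (p ∪ q) q ≡ not (leading (p ∪ q) p)
leading-complement []            []            e ()
leading-complement (inside  ∷ p) (inside  ∷ q) e _ = ⊥-elim (e (zero , here))
leading-complement (inside  ∷ p) (outside ∷ q) e _ = refl
leading-complement (outside ∷ p) (inside  ∷ q) e _ = refl
leading-complement (outside ∷ p) (outside ∷ q) e 0< =
  leading-complement p q (drop-∷-Empty e) 0<

-- The arguments are ∣U∣, ∣A ∖ U∣ and a tie-breaker that changes on complements.
sideBySize : ℕ → ℕ → Bool → Bool
sideBySize 0             _             _ = false
sideBySize 1             _             _ = true
sideBySize (suc (suc _)) 0             _ = true
sideBySize (suc (suc _)) 1             _ = false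
sideBySize (suc (suc _)) (suc (suc _)) b = b

-- The table is arranged so that sizes 0 and 1 are opposite to their complementary sizes. The one
-- clash among positive sizes is 1 against 1, which `3 ≤ x + y` excludes; two sizes of at least 2
-- are separated by the tie-breaker.
sideBySize-swap : ∀ x y b → 3 ≤ x + y → sideBySize x y b ≢ sideBySize y x (not b)
sideBySize-swap 0             (suc (suc _)) b _ ()
sideBySize-swap 0             1             b (s≤s ())
sideBySize-swap 1             0             b (s≤s ())
sideBySize-swap 1             1             b (s≤s (s≤s ()))
sideBySize-swap 1             (suc (suc _)) b _ ()
sideBySize-swap (suc (suc _)) 0             b _ ()
sideBySize-swap (suc (suc _)) 1             b _ ()
sideBySize-swap (suc (suc _)) (suc (suc _)) b _ eq = not-¬ refl eq

-- `true` is the side X and `false` the side Y. For U ⊆ A the truncated difference is the size of A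
-- ∖ U.
side : Subset k → Subset k → Bool
side A U = sideBySize ∣ U ∣ (∣ A ∣ ∸ ∣ U ∣) (leading A U)

-- Passing from U to its complement W in A exchanges the two sizes and negates the tie-breaker.
side-swap : {A : Subset k} (U W : Subset k) → U ∪ W ≡ A → Empty (U ∩ W) → 3 ≤ ∣ A ∣ →
            side A U ≢ side A W
side-swap U W refl e 3≤
  rewrite ∣p∪q∣≡∣p∣+∣q∣ U W e | m+n∸m≡n ∣ U ∣ ∣ W ∣ | m+n∸n≡m ∣ U ∣ ∣ W ∣
        | leading-complement U W e
            (≤-trans (s≤s z≤n) (≤-trans 3≤ (≤-reflexive (sym (∣p∪q∣≡∣p∣+∣q∣ U W e)))))
  = sideBySize-swap ∣ U ∣ ∣ W ∣ (leading (U ∪ W) U) 3≤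

side-⁅x⁆ : (A : Subset k) (x : Fin k) → side A ⁅ x ⁆ ≡ true
side-⁅x⁆ A x rewrite ∣⁅x⁆∣≡1 x = refl

side-self : (A : Subset k) → 3 ≤ ∣ A ∣ → side A A ≡ true
side-self {k} A 3≤ = trans (¬-not (side-swap A ⊥ (∪-identityʳ A) (Empty-p∩⊥ A) 3≤)) (cong not side-⊥)
  where
  side-⊥ : side A ⊥ ≡ false
  side-⊥ rewrite ∣⊥∣≡0 k = refl

-- The colouring of KG(2k, n) and its properness.

halves-disjoint : (S T : Subset (k + k)) → Empty (S ∩ T) →
                  Empty (take k S ∩ take k T) × Empty (drop k S ∩ drop k T)
halves-disjoint {k} S T e = ++-disjoint⁻ (take k S) (take k T) (drop k S) (drop k T)
  (subst₂ (λ S T → Empty (S ∩ T)) (sym (take++drop≡id k S)) (sym (take++drop≡id k T)) e)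

∣take∣+∣drop∣≡∣p∣ : ∀ k (p : Subset (k + m)) → ∣ take k p ∣ + ∣ drop k p ∣ ≡ ∣ p ∣
∣take∣+∣drop∣≡∣p∣ k p =
  trans (sym (∣p++q∣≡∣p∣+∣q∣ (take k p) (drop k p))) (cong ∣_∣ (take++drop≡id k p))

-- If the two halves of S overlap, their union has fewer than n points and some n-set around it is
-- chosen. If they are disjoint, the union has n points and the choice is forced.
hull : n ≤ k → (S : n -subsetsOf (k + k)) →
       Σ (n -subsetsOf k) λ A → take k (proj₁ S) ∪ drop k (proj₁ S) ⊆ proj₁ A
hull {k = k} n≤k (S , ∣S∣≡n) = superset (take k S ∪ drop k S)
  (≤-trans (∣p∪q∣≤∣p∣+∣q∣ (take k S) (drop k S))
           (≤-reflexive (trans (∣take∣+∣drop∣≡∣p∣ k S) ∣S∣≡n)))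
  n≤k

colour : n ≤ k → n -subsetsOf (k + k) → n -subsetsOf k × Bool
colour {k = k} n≤k S = A , side (proj₁ A) (take k (proj₁ S))
  where A = proj₁ (hull n≤k S)

x≤z∧y≤z∧x+y≡z+z⇒x≡z : ∀ {x y z} → x ≤ z → y ≤ z → x + y ≡ z + z → x ≡ z
x≤z∧y≤z∧x+y≡z+z⇒x≡z {x} {y} {z} x≤z y≤z eq = ≤-antisym x≤z
  (+-cancelʳ-≤ z z x (≤-trans (≤-reflexive (sym eq)) (+-monoʳ-≤ x y≤z)))

-- Double counting: the first halves are disjoint inside A, and so are the second halves, so each
-- pair has at most n points in all. Together they have 2n, hence both bounds are attained and the
-- first halves fill A.
halves-partition : (A : n -subsetsOf k) (S T : n -subsetsOf (k + k)) → Disjoint S T →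
  take k (proj₁ S) ∪ drop k (proj₁ S) ⊆ proj₁ A →
  take k (proj₁ T) ∪ drop k (proj₁ T) ⊆ proj₁ A →
  take k (proj₁ S) ∪ take k (proj₁ T) ≡ proj₁ A
halves-partition {n} {k} (A , ∣A∣≡n) (S , ∣S∣≡n) (T , ∣T∣≡n) disj S⊆A T⊆A =
  p⊆q∧∣q∣≤∣p∣⇒p≡q takes⊆A
    (≤-reflexive (trans ∣A∣≡n (sym (trans (∣p∪q∣≡∣p∣+∣q∣ U U′ dU) ∣U∣+∣U′∣≡n))))
  where
  U  = take k S
  U′ = take k T
  W  = drop k S
  W′ = drop k T
  dU = proj₁ (halves-disjoint S T disj)
  dW = proj₂ (halves-disjoint S T disj)

  takes⊆A : U ∪ U′ ⊆ A
  takes⊆A = ∪-lub {p = U} (λ i → S⊆A (p⊆p∪q W i)) (λ i → T⊆A (p⊆p∪q W′ i))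

  drops⊆A : W ∪ W′ ⊆ A
  drops⊆A = ∪-lub {p = W} (λ i → S⊆A (q⊆p∪q U W i)) (λ i → T⊆A (q⊆p∪q U′ W′ i))

  disjoint-bound : ∀ {p q} → Empty (p ∩ q) → p ∪ q ⊆ A → ∣ p ∣ + ∣ q ∣ ≤ n
  disjoint-bound {p} {q} e ⊆A =
    subst₂ _≤_ (∣p∪q∣≡∣p∣+∣q∣ p q e) ∣A∣≡n (p⊆q⇒∣p∣≤∣q∣ ⊆A)

  ∣U∣+∣U′∣≡n : ∣ U ∣ + ∣ U′ ∣ ≡ n
  ∣U∣+∣U′∣≡n = x≤z∧y≤z∧x+y≡z+z⇒x≡z
    (disjoint-bound dU takes⊆A) (disjoint-bound dW drops⊆A)
    (trans (interchange (∣ U ∣) (∣ U′ ∣) (∣ W ∣) (∣ W′ ∣))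
           (cong₂ _+_ (trans (∣take∣+∣drop∣≡∣p∣ k S) ∣S∣≡n)
                      (trans (∣take∣+∣drop∣≡∣p∣ k T) ∣T∣≡n)))

colour-proper : (n≤k : n ≤ k) → 3 ≤ n → (S T : n -subsetsOf (k + k)) → Disjoint S T →
                colour n≤k S ≢ colour n≤k T
colour-proper {k = k} n≤k 3≤n S T disj same =
  side-swap U U′ partition (proj₁ (halves-disjoint (proj₁ S) (proj₁ T) disj))
    (≤-trans 3≤n (≤-reflexive (sym (proj₂ A))))
    (subst (λ B → side (proj₁ A) U ≡ side (proj₁ B) U′) (sym A≡A′) (cong proj₂ same))
  where
  U  = take k (proj₁ S)
  U′ = take k (proj₁ T)
  A  = proj₁ (hull n≤k S)
  A≡A′ = cong proj₁ same
  partition = halves-partition A S T disj (proj₂ (hull n≤k S))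
    (subst (λ B → U′ ∪ drop k (proj₁ T) ⊆ proj₁ B) (sym A≡A′) (proj₂ (hull n≤k T)))

colour-++ : (n≤k : n ≤ k) (A : n -subsetsOf k) (U W : Subset k) (eq : ∣ U ++ W ∣ ≡ n) →
            U ∪ W ≡ proj₁ A → colour n≤k (U ++ W , eq) ≡ (A , side (proj₁ A) U)
colour-++ {k = k} n≤k A U W eq U∪W≡A = cong₂ _,_ hull≡A (cong₂ side (cong proj₁ hull≡A) take≡U)
  where
  take≡U : take k (U ++ W) ≡ U
  take≡U = ++-injectiveˡ (take k (U ++ W)) U (take++drop≡id k (U ++ W))

  drop≡W : drop k (U ++ W) ≡ W
  drop≡W = ++-injectiveʳ (take k (U ++ W)) U (take++drop≡id k (U ++ W))

  hull≡A : proj₁ (hull n≤k (U ++ W , eq)) ≡ A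
  hull≡A = sym (⊆⇒-subsetsOf-≡ A _ (subst (_⊆ proj₁ (proj₁ (hull n≤k (U ++ W , eq))))
    (trans (cong₂ _∪_ take≡U drop≡W) U∪W≡A) (λ {x} → proj₂ (hull n≤k (U ++ W , eq)) {x})))

-- Dominating vertices and their neighbours in KG(2k, n).

-- U goes to the copy named by the Boolean and W to the other, so that one argument serves both
-- sides.
place : Bool → Subset k → Subset k → Subset (k + k)
place true  U W = U ++ W
place false U W = W ++ U

∣place∣ : ∀ b (U W : Subset k) → ∣ place b U W ∣ ≡ ∣ U ∣ + ∣ W ∣
∣place∣ true  U W = ∣p++q∣≡∣p∣+∣q∣ U W
∣place∣ false U W = trans (∣p++q∣≡∣p∣+∣q∣ W U) (+-comm ∣ W ∣ ∣ U ∣)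

place-disjoint : ∀ b (U U′ W W′ : Subset k) → Empty (U ∩ U′) → Empty (W ∩ W′) →
                 Empty (place b U W ∩ place b U′ W′)
place-disjoint true  U U′ W W′ d e = ++-disjoint⁺ U U′ W W′ d e
place-disjoint false U U′ W W′ d e = ++-disjoint⁺ W W′ U U′ e d

place-not : ∀ b (U W : Subset k) → place (not b) U W ≡ place b W U
place-not true  U W = refl
place-not false U W = refl

module _ (n≤k : n ≤ k) (3≤n : 3 ≤ n) (A : n -subsetsOf k) where

  3≤∣A∣ : 3 ≤ ∣ proj₁ A ∣
  3≤∣A∣ = ≤-trans 3≤n (≤-reflexive (sym (proj₂ A)))

  placed : ∀ b (U W : Subset k) → U ∪ W ≡ proj₁ A → Empty (U ∩ W) → side (proj₁ A) U ≡ true →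
           Σ (n -subsetsOf (k + k)) λ S → proj₁ S ≡ place b U W × colour n≤k S ≡ (A , b)
  placed b U W U∪W≡A disj sideU = (place b U W , size) , refl , colour≡ b size
    where
    size : ∣ place b U W ∣ ≡ n
    size = trans (∣place∣ b U W)
      (trans (sym (∣p∪q∣≡∣p∣+∣q∣ U W disj)) (trans (cong ∣_∣ U∪W≡A) (proj₂ A)))

    colour≡ : ∀ b (size : ∣ place b U W ∣ ≡ n) → colour n≤k (place b U W , size) ≡ (A , b)
    colour≡ true  size = trans (colour-++ n≤k A U W size U∪W≡A) (cong (A ,_) sideU)
    -- Here the first copy carries W, the complement of U in A, so its side is opposite to that of
    -- U.
    colour≡ false size = trans (colour-++ n≤k A W U size (trans (∪-comm W U) U∪W≡A))
      (cong (A ,_) (trans (¬-not (side-swap U W U∪W≡A disj 3≤∣A∣ ∘ sym)) (cong not sideU)))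

  placed-whole : ∀ b → Σ (n -subsetsOf (k + k)) λ S →
                 proj₁ S ≡ place b (proj₁ A) ⊥ × colour n≤k S ≡ (A , b)
  placed-whole b = placed b (proj₁ A) ⊥ (∪-identityʳ (proj₁ A)) (Empty-p∩⊥ (proj₁ A))
    (side-self (proj₁ A) 3≤∣A∣)

  placed-singleton : ∀ b {x} → x ∈ proj₁ A → Σ (n -subsetsOf (k + k)) λ S →
                     proj₁ S ≡ place b ⁅ x ⁆ (proj₁ A - x) × colour n≤k S ≡ (A , b)
  placed-singleton b {x} x∈A = placed b ⁅ x ⁆ (proj₁ A - x) (⁅x⁆∪[p-x]≡p x∈A)
    (Empty-p∩[q─p] ⁅ x ⁆ (proj₁ A)) (side-⁅x⁆ (proj₁ A) x)

  -- All of A is put in the copy that P does not use.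
  avoid-opposite : ∀ b (P : Subset k) → ∃ λ S → Empty (place b P ⊥ ∩ proj₁ S) ×
                   colour n≤k S ≡ (A , not b)
  avoid-opposite b P with placed-whole (not b)
  ... | S , S≡ , colour≡ = S ,
    subst (λ T → Empty (place b P ⊥ ∩ T)) (sym (trans S≡ (place-not b (proj₁ A) ⊥)))
      (place-disjoint b P ⊥ ⊥ (proj₁ A) (Empty-p∩⊥ P) (Empty-⊥∩p (proj₁ A))) ,
    colour≡

  -- A point x of A outside P goes to the copy of P, and the rest of A to the other copy. A
  -- singleton has side `true`, so this vertex gets the colour of the copy holding x.
  avoid-same : ∀ b (P : Subset k) → proj₁ A ⊈ P → ∃ λ S → Empty (place b P ⊥ ∩ proj₁ S) ×
               colour n≤k S ≡ (A , b)
  avoid-same b P A⊈P with p⊈q⇒∃∈∉ A⊈P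
  ... | x , x∈A , x∉P with placed-singleton b x∈A
  ...   | S , S≡ , colour≡ = S ,
    subst (λ T → Empty (place b P ⊥ ∩ T)) (sym S≡)
      (place-disjoint b P ⁅ x ⁆ ⊥ (proj₁ A - x)
        (Empty-comm ⁅ x ⁆ P (Empty-⁅x⁆∩p x∉P)) (Empty-⊥∩p (proj₁ A - x))) ,
    colour≡

-- The size of P is left free: P has n points for the dominating vertices of KG(2k, n), and n - 1
-- for the vertex that dominates the extra colour when m is odd.
avoid : (n≤k : n ≤ k) → 3 ≤ n → ∀ b (P : Subset k) (A : n -subsetsOf k) (c : Bool) →
        (c ≡ b → proj₁ A ⊈ P) →
        ∃ λ S → Empty (place b P ⊥ ∩ proj₁ S) × colour n≤k S ≡ (A , c)
avoid n≤k 3≤n true  P A true  A⊈P = avoid-same     n≤k 3≤n A true  P (A⊈P refl)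
avoid n≤k 3≤n true  P A false A⊈P = avoid-opposite n≤k 3≤n A true  P
avoid n≤k 3≤n false P A true  A⊈P = avoid-opposite n≤k 3≤n A false P
avoid n≤k 3≤n false P A false A⊈P = avoid-same     n≤k 3≤n A false P (A⊈P refl)

KG-isBColoring : .{{_ : NonZero n}} (n≤k : n ≤ k) → 3 ≤ n →
                 IsBColoringBy (KG (k + k) n) (colour n≤k)
KG-isBColoring {n} {k} n≤k 3≤n = colour-proper n≤k 3≤n , dominating
  where
  dominating : ∀ i → ∃ λ S → colour n≤k S ≡ i ×
    (∀ j → j ≢ colour n≤k S → ∃ λ T → Disjoint S T × colour n≤k T ≡ j)
  dominating (A , b) with placed-whole n≤k 3≤n A b
  ... | S , S≡ , colour≡ = S , colour≡ , λ (B , c) j≢ →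
    -- On the same side, B ⊆ A would force B = A by size, and then the two colours would coincide.
    let T , disj , eq = avoid n≤k 3≤n b (proj₁ A) B c λ c≡b B⊆A →
          j≢ (trans (cong₂ _,_ (⊆⇒-subsetsOf-≡ B A B⊆A) c≡b) (sym colour≡))
    in T , subst (λ R → Empty (R ∩ proj₁ T)) (sym S≡) disj , eq

-- The witness is an n-set P in the first copy, too small to contain any of the (n + 1)-sets that
-- serve as colours.
KG-avoids-smaller : (n≤k : suc n ≤ k) → 3 ≤ suc n → Σ (n -subsetsOf (k + k)) λ S →
  ∀ j → ∃ λ T → Empty (proj₁ S ∩ proj₁ T) × colour n≤k T ≡ j
KG-avoids-smaller {n} {k} n≤k 3≤n =
  (P ++ ⊥ , trans (∣place∣ true P ⊥) (trans (cong₂ _+_ ∣P∣≡n (∣⊥∣≡0 k)) (+-identityʳ n))) ,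
  λ (A , c) → avoid n≤k 3≤n true P A c λ _ A⊆P →
    <⇒≱ (≤-reflexive (trans (cong suc ∣P∣≡n) (sym (proj₂ A)))) (p⊆q⇒∣p∣≤∣q∣ A⊆P)
  where
  smaller = superset ⊥ (≤-trans (≤-reflexive (∣⊥∣≡0 k)) z≤n) (≤-trans (n≤1+n n) n≤k)
  P = proj₁ (proj₁ smaller)
  ∣P∣≡n = proj₂ (proj₁ smaller)

-- One additional point and one additional colour.

Empty-outside∷ : {p : Subset m} → Empty p → Empty (outside ∷ p)
Empty-outside∷ e (suc x , there x∈p) = e (x , x∈p)

extendColour : {K : Set} → (suc n -subsetsOf m → K) → suc n -subsetsOf (suc m) → Unit.⊤ ⊎ K
extendColour c (inside  ∷ A , _)  = inj₁ Unit.tt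
extendColour c (outside ∷ A , eq) = inj₂ (c (A , eq))

-- Vertices through the new point pairwise meet, so they may share a colour. The new point together
-- with `S` dominates that colour. An old dominating vertex sees it because `suc n + n ≤ m` leaves n
-- old points outside that vertex, which the new point completes to a neighbour.
extendColour-isBColoring : {K : Set} (c : suc n -subsetsOf m → K) →
  IsBColoringBy (KG m (suc n)) c → suc n + n ≤ m →
  (S : n -subsetsOf m) → (∀ j → ∃ λ T → Empty (proj₁ S ∩ proj₁ T) × c T ≡ j) →
  IsBColoringBy (KG (suc m) (suc n)) (extendColour c)
extendColour-isBColoring {n} {m} c (proper , dominating) 1+n+n≤m (S , ∣S∣≡n) avoids =
  proper′ , dominating′
  where
  G = KG (suc m) (suc n)
  open FiniteSimpleGraph G using (_~_)

  proper′ : ∀ A B → A ~ B → extendColour c A ≢ extendColour c B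
  proper′ (inside  ∷ A , _) (inside  ∷ B , _) disj _  = disj (zero , here)
  proper′ (outside ∷ A , a) (outside ∷ B , b) disj eq =
    proper (A , a) (B , b) (drop-∷-Empty disj) (inj₂-injective eq)

  fresh : (A : suc n -subsetsOf m) → Σ (n -subsetsOf m) λ B → proj₁ B ⊆ ∁ (proj₁ A)
  fresh (A , a) = subset n (∁ A) (subst (n ≤_) (sym (trans (∣∁p∣≡n∸∣p∣ A) (cong (m ∸_) a)))
    (m+n≤o⇒m≤o∸n n (subst (_≤ m) (+-comm (suc n) n) 1+n+n≤m)))

  dominating′ : ∀ i → ∃ λ A → extendColour c A ≡ i ×
    (∀ j → j ≢ extendColour c A → ∃ λ B → A ~ B × extendColour c B ≡ j)
  dominating′ (inj₁ Unit.tt) = (inside ∷ S , cong suc ∣S∣≡n) , refl , λ where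
    (inj₁ _) j≢ → ⊥-elim (j≢ refl)
    (inj₂ j) _  → let (T , t) , disj , eq = avoids j in
      (outside ∷ T , t) , Empty-outside∷ disj , cong inj₂ eq
  dominating′ (inj₂ i) with dominating i
  ... | (A , a) , cA≡i , sees = (outside ∷ A , a) , cong inj₂ cA≡i , λ where
    (inj₁ _) _  → let (B , b) , B⊆∁A = fresh (A , a) in
      (inside ∷ B , cong suc b) ,
      Empty-outside∷ (λ (x , x∈) → let x∈A , x∈B = x∈p∩q⁻ A B x∈ in x∈∁p⇒x∉p (B⊆∁A x∈B) x∈A) ,
      refl
    (inj₂ j) j≢ → let (B , b) , disj , eq = sees j (λ j≡ → j≢ (cong inj₂ j≡)) in
      (outside ∷ B , b) , Empty-outside∷ disj , cong inj₂ eq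

-- Counting the colours and the two parities of m.

colours↔Fin : ∀ k n → (n -subsetsOf k × Bool) ↔ Fin (2 * (k C n))
colours↔Fin k n = subst (λ t → (n -subsetsOf k × Bool) ↔ Fin t) (*-comm (k C n) 2)
  (↔-trans (-subsetsOf↔Fin k n ×-↔ ↔-sym Fin.2↔Bool) (↔-sym Fin.*↔×))

χ_b-even : ∀ k n .{{_ : NonZero n}} → 3 ≤ n → n ≤ k → χ_b (KG (k + k) n) ≥ 2 * (k C n)
χ_b-even k n 3≤n n≤k = χ_b-upper (KG (k + k) n)
  (hasBColoring (KG (k + k) n) (colours↔Fin k n) (colour n≤k) (KG-isBColoring n≤k 3≤n))

χ_b-odd : ∀ k n .{{_ : NonZero n}} → 3 ≤ n → n ≤ k → χ_b (KG (suc (k + k)) n) ≥ 2 * (k C n)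
-- The extended colouring has one colour more than the bound asks for; `n≤1+n` gives it away.
χ_b-odd k (suc n) 3≤n n≤k = ≤-trans (n≤1+n _) (χ_b-upper (KG (suc (k + k)) (suc n))
  (hasBColoring (KG (suc (k + k)) (suc n))
    (↔-trans (↔-sym Fin.1↔⊤ ⊎-↔ colours↔Fin k (suc n)) (↔-sym Fin.+↔⊎))
    (extendColour (colour n≤k))
    (extendColour-isBColoring (colour n≤k) (KG-isBColoring n≤k 3≤n)
      (+-mono-≤ n≤k (≤-trans (n≤1+n n) n≤k))
      (proj₁ avoiding) (proj₂ avoiding))))
  where avoiding = KG-avoids-smaller n≤k 3≤n

parity : ∀ m → m ≡ ⌊ m /2⌋ + ⌊ m /2⌋ ⊎ m ≡ suc (⌊ m /2⌋ + ⌊ m /2⌋)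
parity 0             = inj₁ refl
parity 1             = inj₂ refl
parity (suc (suc m)) with parity m
... | inj₁ eq = inj₁ (cong suc (trans (cong suc eq) (sym (+-suc ⌊ m /2⌋ ⌊ m /2⌋))))
... | inj₂ eq = inj₂ (cong (λ x → suc (suc x)) (trans eq (sym (+-suc ⌊ m /2⌋ ⌊ m /2⌋))))

theorem1 : ∀ (m n : ℕ) .{{_ : NonZero n}} → n ≥ 3 → m ≥ 2 * n →
    χ_b (KG m n) ≥ 2 * (⌊ m /2⌋ C n)
theorem1 m n 3≤n 2n≤m = [ (λ m≡ → transport m≡ (χ_b-even ⌊ m /2⌋ n 3≤n n≤⌊m/2⌋))
                        , (λ m≡ → transport m≡ (χ_b-odd  ⌊ m /2⌋ n 3≤n n≤⌊m/2⌋)) ]′ (parity m)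
  where
  n≤⌊m/2⌋ : n ≤ ⌊ m /2⌋
  n≤⌊m/2⌋ = subst (_≤ ⌊ m /2⌋)
    -- `2 * n` unfolds to `n + (n + 0)`, so the trailing zero has to be matched before halving.
    (sym (trans (n≡⌊n+n/2⌋ n) (cong (λ x → ⌊ n + x /2⌋) (sym (+-identityʳ n)))))
    (⌊n/2⌋-mono 2n≤m)

  transport : ∀ {m′} → m ≡ m′ → χ_b (KG m′ n) ≥ 2 * (⌊ m /2⌋ C n) →
              χ_b (KG m n) ≥ 2 * (⌊ m /2⌋ C n)
  transport m≡m′ = subst (λ m′ → χ_b (KG m′ n) ≥ 2 * (⌊ m /2⌋ C n)) (sym m≡m′)
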